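{- Let $G=(V,E)$ be a finite simple undirected graph with complement $G^c$. Suppose that (P2) every edge $e\in E$ lies in a unique triangle (3-cycle) of $G$, and (P3) every non-edge $e\in E^c$ lies in a unique quadrilateral (4-cycle) of $G^c$. Then $|V|<9$.
   Context: A triangle is a cycle of length 3 and a quadrilateral is a cycle of length 4, regarded as subgraphs; $G^c$ is the graph on $V$ whose edges are the pairs of distinct vertices not joined in $G$. -}

module Defs where

open import Data.Nat using (ℕ)
open import Data.Fin using (Fin)
open import Data.Product using (_×_; Σ; ∃-syntax; _,_)
open import Relation.Binary.PropositionalEquality using (_≡_; _≢_)
open import Relation.Nullary using (¬_; Dec)
open import Level using (0ℓ)

record SimpleGraph (n : ℕ) : Set₁ where
  field
    Adj    : Fin n → Fin n → Set
    sym    : ∀ {x y} → Adj x y → Adj y x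
    irrefl : ∀ {x} → ¬ Adj x x
    dec    : ∀ x y → Dec (Adj x y)
open SimpleGraph public

AdjC : ∀ {n} → SimpleGraph n → Fin n → Fin n → Set
AdjC G x y = (x ≢ y) × ¬ Adj G x y

-- Triangles of G containing the edge {u,v}: such a triangle (as a subgraph)
-- is exactly determined by its third vertex w, adjacent to both u and v.
InTriangle : ∀ {n} → SimpleGraph n → Fin n → Fin n → Fin n → Set
InTriangle G u v w = Adj G u w × Adj G v w

P2 : ∀ {n} → SimpleGraph n → Set
P2 {n} G = ∀ u v → Adj G u v →
  Σ (Fin n) λ w → InTriangle G u v w × (∀ w′ → InTriangle G u v w′ → w′ ≡ w)

-- Quadrilaterals of G^c containing the edge {u,v} of G^c: the 4-cycle
-- u - v - x - y - u (four distinct vertices, all four consecutive pairs edges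
-- of G^c). As a subgraph it is determined by the ordered pair (x , y):
-- x is the other G^c-neighbour of v on it, y the other G^c-neighbour of u.
InQuad : ∀ {n} → SimpleGraph n → Fin n → Fin n → Fin n × Fin n → Set
InQuad G u v (x , y) =
  AdjC G v x × AdjC G x y × AdjC G y u × (u ≢ x) × (v ≢ y)

P3 : ∀ {n} → SimpleGraph n → Set
P3 {n} G = ∀ u v → AdjC G u v →
  Σ (Fin n × Fin n) λ q → InQuad G u v q × (∀ q′ → InQuad G u v q′ → q′ ≡ q)

-- Write H for the complement of G.  By P3, two vertices have at most two common
-- H-neighbours, and an H-edge v p determines the vertex opposite to v on its
-- quadrilateral.  By P2, G induces a perfect matching on every neighbourhood, and
-- a fifth neighbour would put an H-edge on two quadrilaterals; so G-degrees are at
-- most 4.  Suppose n ≥ 9.  The closed neighbourhoods of the ends of a G-edge cover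
-- at most 7 vertices, so these ends have two common H-neighbours p and q, and as
-- they have no third one, both ends have degree 4 and all vertices are accounted
-- for.  For three G-neighbours x, w, c of v, the resulting pairs of H-neighbours of
-- v are disjoint, as x, w and c are opposite to v.  Thus the pairs of w and c
-- lie among the two G-neighbours of x outside the triangle v x w, which is too few.
-- Hence G has no edge, and any two vertices have n − 2 > 2 common H-neighbours.
module Submission where

open import Defs
open import Data.Nat using (ℕ; _<_; _≤_; _+_; _≤?_)
open import Data.Nat.Properties using (≤-trans; <-irrefl; ≮⇒≥; ≰⇒>; n≤1+n)
open import Data.Fin using (Fin; fromℕ<)
open import Data.Fin.Properties using (_≟_; any?; injective⇒≤)
open import Data.List using (List; []; _∷_; _++_; length; lookup)
open import Data.List.Membership.Propositional using (_∈_; _∉_)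
open import Data.List.Membership.DecPropositional using (_∈?_)
open import Data.List.Relation.Binary.Subset.Propositional using (_⊆_)
open import Data.List.Relation.Binary.Subset.Propositional.Properties
  using (∷⁺ʳ; xs⊆xs++ys; xs⊆ys++xs)
open import Data.List.Relation.Unary.Any using (here; there; index)
open import Data.List.Relation.Unary.Any.Properties using (lookup-index)
open import Data.Product using (_×_; ∃; ∃₂; _,_; proj₁; proj₂)
open import Data.Sum using (_⊎_; inj₁; inj₂)
open import Data.Empty using (⊥)
open import Data.Unit using (⊤; tt)
open import Function using (_∘_)
open import Relation.Binary.PropositionalEquality
  using (_≡_; _≢_; refl; trans; cong; ≢-sym) renaming (sym to ≡-sym)
open import Relation.Nullary using (¬_; Dec; yes; no; contradiction; ¬?; _×-dec_)
open import Relation.Nullary.Decidable using (decidable-stable; from-no; from-yes)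

exhaust : ∀ {n} {P : Fin n → Set} → (∀ y → Dec (P y)) → (xs : List (Fin n)) →
          (∀ {y} → P y → y ∈ xs) ⊎ (∃ λ y → P y × y ∉ xs)
exhaust P? xs with any? (λ y → P? y ×-dec ¬? (_∈?_ _≟_ y xs))
... | yes found = inj₂ found
... | no ¬found = inj₁ λ {y} py →
  decidable-stable (_∈?_ _≟_ y xs) λ y∉ → ¬found (y , py , y∉)

-- Sending each vertex to its position in `xs` is injective.
covering⇒≤ : ∀ {n} (xs : List (Fin n)) → (∀ y → y ∈ xs) → n ≤ length xs
covering⇒≤ xs cover = injective⇒≤ {f = index ∘ cover} λ {y} {z} eq →
  trans (lookup-index (cover y))
    (trans (cong (lookup xs) eq) (≡-sym (lookup-index (cover z))))

∉-head : ∀ {A : Set} {x y : A} {xs} → y ∉ x ∷ xs → x ≢ y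
∉-head y∉ x≡y = y∉ (here (≡-sym x≡y))

fresh : ∀ {n} (xs : List (Fin n)) → length xs < n → ∃ λ y → y ∉ xs
fresh xs short with exhaust {P = λ _ → ⊤} (λ _ → yes tt) xs
... | inj₂ (y , _ , y∉) = y , y∉
... | inj₁ cover =
  contradiction (≤-trans short (covering⇒≤ xs λ y → cover tt)) (<-irrefl refl)

no-three-in-pair : ∀ {A : Set} {a b x y z : A} → x ≢ y → x ≢ z → y ≢ z →
  x ∈ a ∷ b ∷ [] → y ∈ a ∷ b ∷ [] → z ∈ a ∷ b ∷ [] → ⊥
no-three-in-pair x≢y _ _ (here refl) (here refl) _ = x≢y refl
no-three-in-pair _ x≢z _ (here refl) (there _) (here refl) = x≢z refl
no-three-in-pair _ _ y≢z (here _) (there (here refl)) (there (here refl)) = y≢z refl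
no-three-in-pair _ _ y≢z (there _) (here refl) (here refl) = y≢z refl
no-three-in-pair _ x≢z _ (there (here refl)) (here _) (there (here refl)) = x≢z refl
no-three-in-pair x≢y _ _ (there (here refl)) (there (here refl)) _ = x≢y refl

module _ {n : ℕ} (G : SimpleGraph n) where

  AdjC-sym : ∀ {x y} → AdjC G x y → AdjC G y x
  AdjC-sym (x≢y , ¬xy) = ≢-sym x≢y , ¬xy ∘ sym G

  Adj⇒≢ : ∀ {x y} → Adj G x y → x ≢ y
  Adj⇒≢ xy refl = irrefl G xy

  CommonC : Fin n → Fin n → Fin n → Set
  CommonC u x y = AdjC G u y × AdjC G x y

  Covers : Fin n → List (Fin n) → Set
  Covers v xs = ∀ {y} → Adj G v y → y ∈ xs

  ∉-cover⇒AdjC : ∀ {v y xs ys} → Covers v xs → v ∈ ys → xs ⊆ ys → y ∉ ys → AdjC G v y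
  ∉-cover⇒AdjC cover v∈ xs⊆ys y∉ = (λ { refl → y∉ v∈ }) , y∉ ∘ xs⊆ys ∘ cover

  -- `none` bounds the degree of `v` by 2, `pair` by 4. The further neighbours form an index, so
  -- that lengths compute once the constructor is known.
  data OtherNeighbours (v x w : Fin n) : List (Fin n) → Set where
    none : Covers v (x ∷ w ∷ []) → OtherNeighbours v x w []
    pair : ∀ {c d} → Adj G v c → Adj G v d → c ∉ x ∷ w ∷ [] →
           Covers v (x ∷ w ∷ c ∷ d ∷ []) → OtherNeighbours v x w (c ∷ d ∷ [])

  others-cover : ∀ {v x w xs} → OtherNeighbours v x w xs → Covers v (x ∷ w ∷ xs)
  others-cover (none cover)       = cover
  others-cover (pair _ _ _ cover) = cover

  module _ (p2 : P2 G) (p3 : P3 G) where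

    third-unique : ∀ {u v w w′} → Adj G u v → InTriangle G u v w → InTriangle G u v w′ → w ≡ w′
    third-unique {u} {v} uv t t′ with p2 u v uv
    ... | _ , _ , unique = trans (unique _ t) (≡-sym (unique _ t′))

    quad-unique : ∀ {u v q q′} → AdjC G u v → InQuad G u v q → InQuad G u v q′ → q ≡ q′
    quad-unique {u} {v} uv c c′ with p3 u v uv
    ... | _ , _ , unique = trans (unique _ c) (≡-sym (unique _ c′))

    different-triangles : ∀ {v a b c} → Adj G v a → InTriangle G v a b →
                          Adj G v c → a ≢ c → b ≢ c → AdjC G a c
    different-triangles va t vc a≢c b≢c = a≢c , λ ac → b≢c (third-unique va t (vc , ac))

    -- The quadrilaterals `u p x q` and `u p x r` share the H-edge `u p`.
    no-three-common : ∀ {u x p q r} → u ≢ x → CommonC u x p → CommonC u x q → CommonC u x r →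
                      p ≢ q → p ≢ r → q ≡ r
    no-three-common u≢x (up , xp) (uq , xq) (ur , xr) p≢q p≢r =
      cong proj₂ (quad-unique up
        (AdjC-sym xp , xq , AdjC-sym uq , u≢x , p≢q)
        (AdjC-sym xp , xr , AdjC-sym ur , u≢x , p≢r))

    -- Both `u p x q` and `u p x′ q′` are quadrilaterals on the H-edge `u p`, so their vertices
    -- opposite to `u` agree.
    opposite-unique : ∀ {u x x′ p q q′} → u ≢ x → u ≢ x′ → p ≢ q → p ≢ q′ →
                      CommonC u x p → CommonC u x q → CommonC u x′ p → CommonC u x′ q′ → x ≡ x′
    opposite-unique u≢x u≢x′ p≢q p≢q′ (up , xp) (uq , xq) (_ , x′p) (uq′ , x′q′) =
      cong proj₁ (quad-unique up
        (AdjC-sym xp , xq , AdjC-sym uq , u≢x , p≢q)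
        (AdjC-sym x′p , x′q′ , AdjC-sym uq′ , u≢x′ , p≢q′))

    -- Distinct triangles at `v` are joined by H-edges only, so the H-edge `x c` would lie on both
    -- quadrilaterals `x c w d` and `x c w e`.
    no-fifth-neighbour : ∀ {v x w c d e} → Adj G v x → InTriangle G v x w →
                         Adj G v c → InTriangle G v c d → c ∉ x ∷ w ∷ [] →
                         Adj G v e → e ∉ x ∷ w ∷ c ∷ d ∷ [] → ⊥
    no-fifth-neighbour {x = x} {w} {c} {d} {e} vx (vw , xw) vc (vd , cd) c∉ ve e∉ =
      ∉-head (e∉ ∘ there ∘ there ∘ there) (cong proj₂ (quad-unique x~c
        (AdjC-sym w~c , w~d , AdjC-sym x~d , Adj⇒≢ xw , Adj⇒≢ cd)
        (AdjC-sym w~c , w~e , AdjC-sym x~e , Adj⇒≢ xw , ∉-head (e∉ ∘ there ∘ there))))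
      where
      off-x : ∀ {y} → Adj G _ y → x ≢ y → w ≢ y → AdjC G x y
      off-x = different-triangles vx (vw , xw)
      off-w : ∀ {y} → Adj G _ y → x ≢ y → w ≢ y → AdjC G w y
      off-w vy x≢y w≢y = different-triangles vw (vx , sym G xw) vy w≢y x≢y
      x≢c : x ≢ c
      x≢c = ∉-head c∉
      w≢c : w ≢ c
      w≢c = ∉-head (c∉ ∘ there)
      x~c : AdjC G x c
      x~c = off-x vc x≢c w≢c
      w~c : AdjC G w c
      w~c = off-w vc x≢c w≢c
      x≢d : x ≢ d
      -- If `d` were `x`, the G-edge `c d` would contradict the H-edge `x c`.
      x≢d refl = proj₂ x~c (sym G cd)
      w≢d : w ≢ d
      w≢d refl = proj₂ w~c (sym G cd)
      x~d : AdjC G x d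
      x~d = off-x vd x≢d w≢d
      w~d : AdjC G w d
      w~d = off-w vd x≢d w≢d
      x≢e : x ≢ e
      x≢e = ∉-head e∉
      w≢e : w ≢ e
      w≢e = ∉-head (e∉ ∘ there)
      x~e : AdjC G x e
      x~e = off-x ve x≢e w≢e
      w~e : AdjC G w e
      w~e = off-w ve x≢e w≢e

    -- A neighbour `c` outside the first triangle brings its partner `d` by P2, and nothing remains
    -- after these two.
    other-neighbours : ∀ {v x w} → Adj G v x → InTriangle G v x w → ∃ (OtherNeighbours v x w)
    other-neighbours {v} {x} {w} vx t with exhaust (dec G v) (x ∷ w ∷ [])
    ... | inj₁ cover = [] , none cover
    ... | inj₂ (c , vc , c∉) with p2 v c vc
    ...   | d , (vd , cd) , _ with exhaust (dec G v) (x ∷ w ∷ c ∷ d ∷ [])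
    ...     | inj₁ cover = _ , pair vc vd c∉ cover
    ...     | inj₂ (e , ve , e∉) with () ← no-fifth-neighbour vx t vc (vd , cd) c∉ ve e∉

    -- Otherwise three distinct vertices could be chosen outside `xs`, all of them common
    -- H-neighbours of `u` and `x`.
    few-common : ∀ {u x} xs → u ≢ x → (∀ {y} → y ∉ xs → CommonC u x y) → n ≤ 2 + length xs
    few-common xs u≢x common = ≮⇒≥ λ short →
      let p , p∉ = fresh xs (≤-trans (n≤1+n _) (≤-trans (n≤1+n _) short))
          q , q∉ = fresh (p ∷ xs) (≤-trans (n≤1+n _) short)
          r , r∉ = fresh (q ∷ p ∷ xs) short
      in ∉-head r∉ (no-three-common u≢x
           (common p∉) (common (q∉ ∘ there)) (common (r∉ ∘ there ∘ there))
           (∉-head q∉) (∉-head (r∉ ∘ there)))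

    common-outside : ∀ {v x w xs ys y} → OtherNeighbours v x w xs → OtherNeighbours x v w ys →
                     y ∉ v ∷ x ∷ w ∷ xs ++ ys → CommonC v x y
    common-outside {v} {x} {w} {xs} {ys} ov ox y∉ =
      ∉-cover⇒AdjC (others-cover ov) (here refl)
        (there ∘ ∷⁺ʳ x (∷⁺ʳ w (xs⊆xs++ys xs ys))) y∉ ,
      ∉-cover⇒AdjC (others-cover ox) (there (here refl))
        (∷⁺ʳ v (there ∘ ∷⁺ʳ w (xs⊆ys++xs ys xs))) y∉

    module _ (9≤n : 9 ≤ n) where

      -- The 5 counts a triangle and two further vertices: each list has length 0 or 2, so 9
      -- vertices leave room for both.
      short-others : ∀ {v x w v′ x′ w′ xs ys} → OtherNeighbours v x w xs →
                     OtherNeighbours v′ x′ w′ ys → 5 + length (xs ++ ys) ≤ n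
      short-others (none _)       (none _)       = ≤-trans (from-yes (5 ≤? 9)) 9≤n
      short-others (none _)       (pair _ _ _ _) = ≤-trans (from-yes (7 ≤? 9)) 9≤n
      short-others (pair _ _ _ _) (none _)       = ≤-trans (from-yes (7 ≤? 9)) 9≤n
      short-others (pair _ _ _ _) (pair _ _ _ _) = 9≤n

      common-pair : ∀ {v x w xs ys} → Adj G v x →
        OtherNeighbours v x w xs → OtherNeighbours x v w ys →
        ∃₂ λ p q → p ≢ q × CommonC v x p × CommonC v x q ×
                   (∀ y → y ∈ p ∷ q ∷ v ∷ x ∷ w ∷ xs ++ ys)
      common-pair {v} {x} {w} {xs} {ys} vx ov ox =
        let zs = v ∷ x ∷ w ∷ xs ++ ys
            short = short-others ov ox
            p , p∉ = fresh zs (≤-trans (n≤1+n _) short)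
            q , q∉ = fresh (p ∷ zs) short
            common : ∀ {y} → y ∉ zs → CommonC v x y
            common = common-outside ov ox
            p≢q = ∉-head q∉
        in p , q , p≢q , common p∉ , common (q∉ ∘ there) , λ y →
           -- A vertex missing from the list would be a third common H-neighbour besides `p` and
           -- `q`.
           decidable-stable (_∈?_ _≟_ y (p ∷ q ∷ zs)) λ y∉ →
             ∉-head (y∉ ∘ there) (no-three-common (Adj⇒≢ vx)
               (common p∉) (common (q∉ ∘ there)) (common (y∉ ∘ there ∘ there))
               p≢q (∉-head y∉))

      two-common : ∀ {v x} → Adj G v x → ∃₂ λ p q → p ≢ q × CommonC v x p × CommonC v x q
      two-common {v} {x} vx =
        let w , (vw , xw) , _ = p2 v x vx
            _ , ov = other-neighbours vx (vw , xw)
            _ , ox = other-neighbours (sym G vx) (xw , vw)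
            p , q , p≢q , cp , cq , _ = common-pair vx ov ox
        in p , q , p≢q , cp , cq

      -- A shared `p` would give the H-edge `v p` two opposite vertices `x` and `x′`. Swapping the
      -- members of a pair yields the other inequalities.
      common-disjoint : ∀ {v x x′ p q p′ q′} → Adj G v x → Adj G v x′ → x ≢ x′ →
        p ≢ q → p′ ≢ q′ → CommonC v x p → CommonC v x q → CommonC v x′ p′ → CommonC v x′ q′ →
        p ≢ p′
      common-disjoint vx vx′ x≢x′ p≢q p′≢q′ cp cq cp′ cq′ refl =
        x≢x′ (opposite-unique (Adj⇒≢ vx) (Adj⇒≢ vx′) p≢q p′≢q′ cp cq cp′ cq′)

      edge-impossible : ∀ {v x w xs ys} → Adj G v x → InTriangle G v x w →
                        OtherNeighbours v x w xs → OtherNeighbours x v w ys → ⊥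
      -- With a `none` at either end, the closed neighbourhoods cover at most 5 vertices, hence `n`
      -- is at most 7.
      edge-impossible vx t ov@(none _) ox@(none _) =
        from-no (9 ≤? 5) (≤-trans 9≤n (few-common _ (Adj⇒≢ vx) (common-outside ov ox)))
      edge-impossible vx t ov@(none _) ox@(pair _ _ _ _) =
        from-no (9 ≤? 7) (≤-trans 9≤n (few-common _ (Adj⇒≢ vx) (common-outside ov ox)))
      edge-impossible vx t ov@(pair _ _ _ _) ox@(none _) =
        from-no (9 ≤? 7) (≤-trans 9≤n (few-common _ (Adj⇒≢ vx) (common-outside ov ox)))
      edge-impossible {v} {x} {w} vx (vw , xw)
        ov@(pair {c} {d} vc vd c∉ _) ox@(pair {c′} {d′} _ _ _ _)
        with common-pair vx ov ox | two-common vw | two-common vc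
      ... | p , q , p≢q , cp , cq , all∈ | p₁ , q₁ , p₁≢q₁ , cp₁ , cq₁ | p₂ , q₂ , p₂≢q₂ , cp₂ , cq₂ =
        -- The pairs of `w` and `c` are disjoint, so `p₁`, `q₁` and `p₂` are three distinct vertices
        -- among `c′` and `d′`.
        no-three-in-pair p₁≢q₁
          (common-disjoint vw vc w≢c p₁≢q₁ p₂≢q₂ cp₁ cq₁ cp₂ cq₂)
          (common-disjoint vw vc w≢c (≢-sym p₁≢q₁) p₂≢q₂ cq₁ cp₁ cp₂ cq₂)
          (located vw (Adj⇒≢ xw) p₁≢q₁ cp₁ cq₁)
          (located vw (Adj⇒≢ xw) (≢-sym p₁≢q₁) cq₁ cp₁)
          (located vc (∉-head c∉) p₂≢q₂ cp₂ cq₂)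
        where
        w≢c : w ≢ c
        w≢c = ∉-head (c∉ ∘ there)
        -- In the full list of vertices, `p` and `q` are excluded by disjointness from the pair of
        -- `x`, and `v` with its G-neighbours because `r` is H-adjacent to `v`.
        located : ∀ {z r s} → Adj G v z → x ≢ z → r ≢ s → CommonC v z r → CommonC v z s →
                  r ∈ c′ ∷ d′ ∷ []
        located {r = r} vz x≢z r≢s cr@((v≢r , ¬vr) , _) cs with all∈ r
        ... | here refl = contradiction refl (common-disjoint vx vz x≢z p≢q r≢s cp cq cr cs)
        ... | there (here refl) =
          contradiction refl (common-disjoint vx vz x≢z (≢-sym p≢q) r≢s cq cp cr cs)
        ... | there (there (here refl)) = contradiction refl v≢r
        ... | there (there (there (here refl))) = contradiction vx ¬vr
        ... | there (there (there (there (here refl)))) = contradiction vw ¬vr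
        ... | there (there (there (there (there (here refl))))) = contradiction vc ¬vr
        ... | there (there (there (there (there (there (here refl)))))) = contradiction vd ¬vr
        ... | there (there (there (there (there (there (there r∈)))))) = r∈

      no-edges : ∀ {v x} → ¬ Adj G v x
      no-edges {v} {x} vx =
        let w , (vw , xw) , _ = p2 v x vx
            _ , ov = other-neighbours vx (vw , xw)
            _ , ox = other-neighbours (sym G vx) (xw , vw)
        in edge-impossible vx (vw , xw) ov ox

      contradictory : ⊥
      contradictory =
        let u = fromℕ< (≤-trans (from-yes (1 ≤? 9)) 9≤n)
            x , x∉ = fresh (u ∷ []) (≤-trans (from-yes (2 ≤? 9)) 9≤n)
        -- Without G-edges every vertex other than `u` and `x` is a common H-neighbour, which gives
        -- the bound 2 + 2.
        in from-no (9 ≤? 4) (≤-trans 9≤n (few-common (u ∷ x ∷ []) (∉-head x∉)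
             λ y∉ → (∉-head y∉ , no-edges) , (∉-head (y∉ ∘ there) , no-edges)))

theorem2 : (n : ℕ) (G : SimpleGraph n) → P2 G → P3 G → n < 9
theorem2 n G p2 p3 = ≰⇒> (contradictory G p2 p3)
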